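{- If $G$ is a connected identifiable graph with $\gamma^{\mathrm{L}}(G)\geq 2$, then $\gamma_t^{\mathrm{ID}}(G)\leq 3\gamma^{\mathrm{L}}(G)-\log_2(\gamma^{\mathrm{L}}(G)+1)$.
   Context: All graphs are finite, simple and undirected. $N[v]$ is the closed neighbourhood of $v$; for $C\subseteq V(G)$, $I(v)=N[v]\cap C$. A locating-dominating set is a dominating set $C$ such that $I(u)\neq I(v)$ for all distinct $u,v\notin C$; $\gamma^{\mathrm{L}}(G)$ is its minimum size. A total dominating identifying code is a set $C$ with $I(u)\neq I(v)$ for all distinct vertices $u,v$ and such that every vertex has a neighbour in $C$; $\gamma_t^{\mathrm{ID}}(G)$ is its minimum size. A graph is identifiable if it has no distinct $u,v$ with $N[u]=N[v]$. -}

module Defs where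

open import Data.Nat using (ℕ; _≤_)
open import Data.Bool using (Bool; true; false; _∨_)
open import Data.Fin using (Fin; _≟_)
open import Data.Fin.Subset using (Subset; _∈_; _∉_; _∩_; Nonempty; ∣_∣)
open import Data.Vec using (tabulate)
open import Data.Product using (Σ; ∃; _×_)
open import Relation.Nullary using (¬_)
open import Relation.Nullary.Decidable using (⌊_⌋)
open import Relation.Binary.PropositionalEquality using (_≡_; _≢_)

record Graph (n : ℕ) : Set where
  field
    adj    : Fin n → Fin n → Bool
    sym    : ∀ u v → adj u v ≡ adj v u
    irrefl : ∀ v → adj v v ≡ false
open Graph public

module _ {n : ℕ} (G : Graph n) where

  N[_] : Fin n → Subset n
  N[ v ] = tabulate (λ u → ⌊ u ≟ v ⌋ ∨ adj G v u)

  I : Subset n → Fin n → Subset n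
  I C v = N[ v ] ∩ C

  data Reachable : Fin n → Fin n → Set where
    here : ∀ {v} → Reachable v v
    step : ∀ {u w v} → adj G u w ≡ true → Reachable w v → Reachable u v

  Connected : Set
  Connected = ∀ u v → Reachable u v

  Identifiable : Set
  Identifiable = ∀ u v → u ≢ v → N[ u ] ≢ N[ v ]

  Dominating : Subset n → Set
  Dominating C = ∀ v → Nonempty (I C v)

  LocatingDominating : Subset n → Set
  LocatingDominating C =
    Dominating C × (∀ u v → u ∉ C → v ∉ C → u ≢ v → I C u ≢ I C v)

  TotalDominatingIdCode : Subset n → Set
  TotalDominatingIdCode C =
    (∀ u v → u ≢ v → I C u ≢ I C v) ×
    (∀ v → ∃ λ u → adj G v u ≡ true × u ∈ C)

  IsγL : ℕ → Set
  IsγL k = (∃ λ C → LocatingDominating C × ∣ C ∣ ≡ k)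
         × (∀ C → LocatingDominating C → k ≤ ∣ C ∣)

  IsγtID : ℕ → Set
  IsγtID t = (∃ λ C → TotalDominatingIdCode C × ∣ C ∣ ≡ t)
           × (∀ C → TotalDominatingIdCode C → t ≤ ∣ C ∣)

{-# OPTIONS --safe #-}

-- Let C be a locating-dominating set of size k. Going through the vertices of C
-- one at a time, each needs at most one extra vertex to be separated from those
-- treated before, so that C ∪ S is separating for some S disjoint from C with
-- s = |S| ≤ k. Let u be the number of vertices of C with a neighbour in S. The
-- sets I(x), x ∈ S, are distinct nonempty subsets of these u vertices, whence
-- s + 1 ≤ 2 ^ u. Adding one neighbour for each of the other k − u vertices of C
-- gives a total dominating identifying code of size at most 2k + s − u, and
-- k + 1 ≤ 2 ^ u + (k − s) ≤ 2 ^ (u + k − s) bounds the logarithm.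

module Submission where

open import Defs
open import Data.Nat using (ℕ; zero; suc; _≤_; _<_; _+_; _*_; _∸_; _^_; z≤n; s≤s; _<?_)
open import Data.Nat.Logarithm using (⌈log₂_⌉; ⌈log₂⌉-mono-≤; ⌈log₂2^n⌉≡n)
open import Data.Nat.Properties
  using (≤-refl; ≤-reflexive; ≤-trans; <⇒≤; ≮⇒≥; <⇒≱; n≤1+n; +-suc; +-comm; +-assoc; +-identityʳ;
         +-mono-≤; +-monoˡ-≤; +-monoʳ-≤; +-cancelʳ-≤; m+[n∸m]≡n; m^n>0; module ≤-Reasoning)
open import Data.Nat.Induction using (Acc; acc; <-wellFounded)
open import Data.Nat.Tactic.RingSolver using (solve-∀)
open import Data.Bool using (Bool; true; false; _∧_; if_then_else_)
import Data.Bool.Properties as Bool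
open import Data.Fin using (Fin; zero; suc; _≟_; combine)
open import Data.Fin.Properties using (all?; any?; ¬∀⟶∃¬; injective⇒≤; combine-injective; suc-injective)
open import Data.Fin.Subset
  using (Subset; _∈_; _∉_; _⊆_; _∩_; _∪_; _─_; _-_; ⊥; ⁅_⁆; Nonempty; ∣_∣)
open import Data.Fin.Subset.Properties
  using (_∈?_; nonempty?; anySubset?; ∉⊥; ⊥⊆; x∈⁅x⁆; ∣⁅x⁆∣≡1; ∣⊥∣≡0; p⊆q⇒∣p∣≤∣q∣;
         x∈p∩q⁺; x∈p∩q⁻; ∩-assoc; ∩-comm; p⊆p∪q; q⊆p∪q; x∈p∪q⁻; x∈p∪q⁺; ∪-assoc;
         x∈p∧x∉q⇒x∈p─q; ∣p─q∣≤∣p∣; p─q⊆p; x∈p∧x≢y⇒x∈p-y; x∈p⇒∣p-x∣<∣p∣; drop-∷-⊆; ∩-abs-∪)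
open import Data.Vec using ([]; _∷_; lookup; tabulate; here; there)
open import Data.Vec.Properties
  using (lookup∘tabulate; tabulate∘lookup; tabulate-cong; lookup-zipWith; lookup⇒[]=; []=⇒lookup; ≡-dec)
open import Data.Product using (Σ; ∃; _×_; _,_; proj₁; proj₂)
open import Data.Sum using (inj₁; inj₂)
open import Function using (_∘_)
open import Relation.Nullary using (Dec; yes; no; contradiction)
open import Relation.Nullary.Decidable using (⌊_⌋; ¬?; _×-dec_; _→-dec_)
open import Relation.Unary using (Pred; Decidable)
open import Relation.Binary.PropositionalEquality as ≡
  using (_≡_; _≢_; refl; trans; cong; cong₂; subst; module ≡-Reasoning)

private
  variable
    m n : ℕ

-- Finite subsets

∣p∪q∣≤∣p∣+∣q∣ : (p q : Subset n) → ∣ p ∪ q ∣ ≤ ∣ p ∣ + ∣ q ∣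
∣p∪q∣≤∣p∣+∣q∣ []          []          = z≤n
∣p∪q∣≤∣p∣+∣q∣ (false ∷ p) (false ∷ q) = ∣p∪q∣≤∣p∣+∣q∣ p q
∣p∪q∣≤∣p∣+∣q∣ (false ∷ p) (true  ∷ q) =
  ≤-trans (s≤s (∣p∪q∣≤∣p∣+∣q∣ p q)) (≤-reflexive (≡.sym (+-suc ∣ p ∣ ∣ q ∣)))
∣p∪q∣≤∣p∣+∣q∣ (true  ∷ p) (false ∷ q) = s≤s (∣p∪q∣≤∣p∣+∣q∣ p q)
∣p∪q∣≤∣p∣+∣q∣ (true  ∷ p) (true  ∷ q) =
  s≤s (≤-trans (∣p∪q∣≤∣p∣+∣q∣ p q) (+-monoʳ-≤ ∣ p ∣ (n≤1+n ∣ q ∣)))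

∣p∩q∣+∣p─q∣≡∣p∣ : (p q : Subset n) → ∣ p ∩ q ∣ + ∣ p ─ q ∣ ≡ ∣ p ∣
∣p∩q∣+∣p─q∣≡∣p∣ []          []          = refl
∣p∩q∣+∣p─q∣≡∣p∣ (false ∷ p) (false ∷ q) = ∣p∩q∣+∣p─q∣≡∣p∣ p q
∣p∩q∣+∣p─q∣≡∣p∣ (false ∷ p) (true  ∷ q) = ∣p∩q∣+∣p─q∣≡∣p∣ p q
∣p∩q∣+∣p─q∣≡∣p∣ (true  ∷ p) (false ∷ q) =
  trans (+-suc ∣ p ∩ q ∣ ∣ p ─ q ∣) (cong suc (∣p∩q∣+∣p─q∣≡∣p∣ p q))
∣p∩q∣+∣p─q∣≡∣p∣ (true  ∷ p) (true  ∷ q) = cong suc (∣p∩q∣+∣p─q∣≡∣p∣ p q)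

x∈p─q⇒x∉q : (p q : Subset n) {x : Fin n} → x ∈ p ─ q → x ∉ q
x∈p─q⇒x∉q (_ ∷ p) (true  ∷ q) {zero}  ()
x∈p─q⇒x∉q (_ ∷ p) (false ∷ q) {zero}  _         ()
x∈p─q⇒x∉q (_ ∷ p) (_     ∷ q) {suc x} (there d) (there e) = x∈p─q⇒x∉q p q d e

⌊⌋≡true⇒ : ∀ {a} {A : Set a} (A? : Dec A) → ⌊ A? ⌋ ≡ true → A
⌊⌋≡true⇒ (yes a) _ = a

⇒⌊⌋≡true : ∀ {a} {A : Set a} (A? : Dec A) → A → ⌊ A? ⌋ ≡ true
⇒⌊⌋≡true (yes _) _ = refl
⇒⌊⌋≡true (no ¬a) a = contradiction a ¬a

module _ {ℓ} {P : Pred (Fin n) ℓ} (P? : Decidable P) where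

  ⟦_⟧ : Subset n
  ⟦_⟧ = tabulate (λ x → ⌊ P? x ⌋)

  ∈⟦⟧⁺ : ∀ {x} → P x → x ∈ ⟦_⟧
  ∈⟦⟧⁺ {x} px = lookup⇒[]= x _ (trans (lookup∘tabulate _ x) (⇒⌊⌋≡true (P? x) px))

  ∈⟦⟧⁻ : ∀ {x} → x ∈ ⟦_⟧ → P x
  ∈⟦⟧⁻ {x} x∈ = ⌊⌋≡true⇒ (P? x) (trans (≡.sym (lookup∘tabulate _ x)) ([]=⇒lookup x∈))

-- Only a set covering the values of `f` on `p` is needed later, so the size is merely bounded:
-- values may coincide.
image : (f : Fin m → Fin n) (p : Subset m) →
        ∃ λ q → ∣ q ∣ ≤ ∣ p ∣ × (∀ {x} → x ∈ p → f x ∈ q)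
image {n = n} f [] = ⊥ , ≤-reflexive (∣⊥∣≡0 n) , λ ()
image f (false ∷ p) with image (f ∘ suc) p
... | q , q≤ , f∈q = q , q≤ , λ { (there x∈p) → f∈q x∈p }
image f (true ∷ p) with image (f ∘ suc) p
... | q , q≤ , f∈q = ⁅ f zero ⁆ ∪ q , bound , λ where
    here        → x∈p∪q⁺ (inj₁ (x∈⁅x⁆ (f zero)))
    (there x∈p) → x∈p∪q⁺ {p = ⁅ f zero ⁆} (inj₂ (f∈q x∈p))
  where
  bound : ∣ ⁅ f zero ⁆ ∪ q ∣ ≤ suc ∣ p ∣
  bound = ≤-trans (∣p∪q∣≤∣p∣+∣q∣ ⁅ f zero ⁆ q)
            (+-mono-≤ (≤-reflexive (∣⁅x⁆∣≡1 (f zero))) q≤)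

-- Descent on the size: as long as a search over all subsets finds a strictly smaller one with `P`,
-- it replaces the current one. This supplies the exact minimum that `IsγtID` demands.
minimum-size : ∀ {ℓ} {P : Pred (Subset n) ℓ} → Decidable P → ∀ p → P p →
               ∃ λ q → P q × (∀ r → P r → ∣ q ∣ ≤ ∣ r ∣) × ∣ q ∣ ≤ ∣ p ∣
minimum-size {n = n} {P = P} P? p = go p (<-wellFounded ∣ p ∣)
  where
  go : ∀ p → Acc _<_ ∣ p ∣ → P p →
       ∃ λ q → P q × (∀ r → P r → ∣ q ∣ ≤ ∣ r ∣) × ∣ q ∣ ≤ ∣ p ∣
  go p (acc rec) Pp with anySubset? (λ r → P? r ×-dec (∣ r ∣ <? ∣ p ∣))
  ... | no  ¬smaller       = p , Pp , (λ r Pr → ≮⇒≥ (λ r<p → ¬smaller (r , Pr , r<p))) , ≤-refl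
  ... | yes (r , Pr , r<p) with go r (rec r<p) Pr
  ...   | q , Pq , min , q≤r = q , Pq , min , ≤-trans q≤r (<⇒≤ r<p)

-- Counting subsets of a finite set

enumerate : (p : Subset n) → Fin ∣ p ∣ → Fin n
enumerate (true  ∷ p) zero    = zero
enumerate (true  ∷ p) (suc i) = suc (enumerate p i)
enumerate (false ∷ p) i       = suc (enumerate p i)

enumerate-∈ : (p : Subset n) (i : Fin ∣ p ∣) → enumerate p i ∈ p
enumerate-∈ (true  ∷ p) zero    = here
enumerate-∈ (true  ∷ p) (suc i) = there (enumerate-∈ p i)
enumerate-∈ (false ∷ p) i       = there (enumerate-∈ p i)

enumerate-injective : (p : Subset n) {i j : Fin ∣ p ∣} → enumerate p i ≡ enumerate p j → i ≡ j
enumerate-injective (true  ∷ p) {zero}  {zero}  _  = refl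
enumerate-injective (true  ∷ p) {suc i} {suc j} eq = cong suc (enumerate-injective p (suc-injective eq))
enumerate-injective (false ∷ p) eq = enumerate-injective p (suc-injective eq)

bit : Bool → Fin 2
bit b = if b then suc zero else zero

bit-injective : ∀ {a b} → bit a ≡ bit b → a ≡ b
bit-injective {false} {false} _ = refl
bit-injective {true}  {true}  _ = refl

-- The binary number whose digits are those of p at the positions in q.
encode : (q p : Subset n) → Fin (2 ^ ∣ q ∣)
encode []          []      = zero
encode (true  ∷ q) (b ∷ p) = combine (bit b) (encode q p)
encode (false ∷ q) (_ ∷ p) = encode q p

-- `encode` forgets the entries outside `q`; the two inclusions force those entries to be `false`,
-- so nothing is lost.
encode-injective : (q : Subset n) {p p′ : Subset n} → p ⊆ q → p′ ⊆ q →
                   encode q p ≡ encode q p′ → p ≡ p′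
encode-injective [] {[]} {[]} _ _ _ = refl
encode-injective (true ∷ q) {b ∷ p} {b′ ∷ p′} p⊆q p′⊆q eq
  with combine-injective (bit b) (encode q p) (bit b′) (encode q p′) eq
... | eq₁ , eq₂ = cong₂ _∷_ (bit-injective eq₁)
                    (encode-injective q (drop-∷-⊆ p⊆q) (drop-∷-⊆ p′⊆q) eq₂)
encode-injective (false ∷ q) {false ∷ p} {false ∷ p′} p⊆q p′⊆q eq =
  cong (false ∷_) (encode-injective q (drop-∷-⊆ p⊆q) (drop-∷-⊆ p′⊆q) eq)
encode-injective (false ∷ q) {true ∷ _} p⊆q _ _ with () ← p⊆q here
encode-injective (false ∷ q) {false ∷ _} {true ∷ _} _ p′⊆q _ with () ← p′⊆q here

-- The values of `f` on `p` miss the empty set, so adjoining it as one more value keeps the family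
-- injective; this accounts for the `suc`.
distinct-nonempty-subsets : (p : Subset m) (q : Subset n) (f : Fin m → Subset n) →
  (∀ {x} → x ∈ p → f x ⊆ q) → (∀ {x} → x ∈ p → Nonempty (f x)) →
  (∀ {x y} → x ∈ p → y ∈ p → f x ≡ f y → x ≡ y) →
  suc ∣ p ∣ ≤ 2 ^ ∣ q ∣
distinct-nonempty-subsets {n = n} p q f f⊆q f≢∅ f-inj =
  injective⇒≤ {f = encode q ∘ g} (λ {i} {j} → g-inj i j ∘ encode-injective q (g⊆q i) (g⊆q j))
  where
  g : Fin (suc ∣ p ∣) → Subset n
  g zero    = ⊥
  g (suc i) = f (enumerate p i)

  g⊆q : ∀ i → g i ⊆ q
  g⊆q zero    = ⊥⊆
  g⊆q (suc i) = f⊆q (enumerate-∈ p i)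

  ⊥≢g : ∀ i → ⊥ ≢ g (suc i)
  ⊥≢g i eq with f≢∅ (enumerate-∈ p i)
  ... | x , x∈ = ∉⊥ (subst (x ∈_) (≡.sym eq) x∈)

  g-inj : ∀ i j → g i ≡ g j → i ≡ j
  g-inj zero    zero    _  = refl
  g-inj zero    (suc j) eq = contradiction eq (⊥≢g j)
  g-inj (suc i) zero    eq = contradiction (≡.sym eq) (⊥≢g i)
  g-inj (suc i) (suc j) eq =
    cong suc (enumerate-injective p (f-inj (enumerate-∈ p i) (enumerate-∈ p j) eq))

-- Separation and domination

module _ {n : ℕ} (G : Graph n) where

  -- `P` holds the vertices not yet treated: `P = D = C` is the locating property of `C`, and for
  -- empty `P` all vertices are separated.
  SeparatesOff : Subset n → Subset n → Set
  SeparatesOff P D = ∀ {u v} → u ∉ P → v ∉ P → I G D u ≡ I G D v → u ≡ v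

  ∈N⇒adj : ∀ {v x} → x ∈ N[_] G v → x ≢ v → adj G v x ≡ true
  ∈N⇒adj {v} {x} x∈N x≢v with x ≟ v | trans (≡.sym (lookup∘tabulate _ x)) ([]=⇒lookup x∈N)
  ... | yes x≡v | _   = contradiction x≡v x≢v
  ... | no  _   | adj = adj

  I-∪ : ∀ D E v → I G (D ∪ E) v ∩ D ≡ I G D v
  I-∪ D E v = begin
    (N[_] G v ∩ (D ∪ E)) ∩ D  ≡⟨ ∩-assoc (N[_] G v) (D ∪ E) D ⟩
    N[_] G v ∩ ((D ∪ E) ∩ D)  ≡⟨ cong (N[_] G v ∩_) (∩-comm (D ∪ E) D) ⟩
    N[_] G v ∩ (D ∩ (D ∪ E))  ≡⟨ cong (N[_] G v ∩_) (∩-abs-∪ D E) ⟩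
    N[_] G v ∩ D              ∎
    where open ≡-Reasoning

  -- Enlarging a set never destroys a separation, since intersecting with `D` recovers the old
  -- I-sets.
  I-∪-injective : ∀ D E {u v} → I G (D ∪ E) u ≡ I G (D ∪ E) v → I G D u ≡ I G D v
  I-∪-injective D E {u} {v} eq =
    trans (≡.sym (I-∪ D E u)) (trans (cong (_∩ D) eq) (I-∪ D E v))

  lookup-I : ∀ {D x} → x ∈ D → ∀ v → lookup (I G D v) x ≡ lookup (N[_] G v) x
  lookup-I {D} {x} x∈D v = begin
    lookup (I G D v) x                 ≡⟨ lookup-zipWith _∧_ x (N[_] G v) D ⟩
    lookup (N[_] G v) x ∧ lookup D x   ≡⟨ cong (lookup (N[_] G v) x ∧_) ([]=⇒lookup x∈D) ⟩
    lookup (N[_] G v) x ∧ true         ≡⟨ Bool.∧-identityʳ _ ⟩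
    lookup (N[_] G v) x                ∎
    where open ≡-Reasoning

  -- Any `x` in exactly one of the two closed neighbourhoods works, whatever else `D` contains.
  separator : ∀ {u v} → N[_] G u ≢ N[_] G v → ∃ λ x → ∀ {D} → x ∈ D → I G D u ≢ I G D v
  separator {u} {v} Nu≢Nv
    with ¬∀⟶∃¬ n _ (λ x → lookup (N[_] G u) x Bool.≟ lookup (N[_] G v) x) (Nu≢Nv ∘ ext)
    where
    ext : (∀ x → lookup (N[_] G u) x ≡ lookup (N[_] G v) x) → N[_] G u ≡ N[_] G v
    ext eq = trans (≡.sym (tabulate∘lookup _)) (trans (tabulate-cong eq) (tabulate∘lookup _))
  ... | x , ≢x = x , λ x∈D eq →
    ≢x (trans (≡.sym (lookup-I x∈D u)) (trans (cong (λ p → lookup p x) eq) (lookup-I x∈D v)))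

  -- A vertex c shares its I-set with at most one r ∉ P, since the vertices
  -- outside P are already separated; hence one new vertex suffices for c.
  separate-one : Identifiable G → ∀ {P D c} → c ∈ P → SeparatesOff P D →
                 ∃ λ x → SeparatesOff (P - c) (D ∪ ⁅ x ⁆)
  separate-one ident {P} {D} {c} c∈P sep
    with any? (λ r → ¬? (r ∈? P) ×-dec ≡-dec Bool._≟_ (I G D r) (I G D c))
  -- Here `D` already separates `c`; the vertex to be returned is arbitrary, and `c` serves as a
  -- default.
  ... | no ¬twin = c , λ {u} {v} u∉ v∉ → extend u∉ v∉ ∘ I-∪-injective D ⁅ c ⁆
    where
    extend : SeparatesOff (P - c) D
    extend {u} {v} u∉ v∉ eq with u ≟ c | v ≟ c
    ... | yes refl | yes refl = refl
    ... | yes refl | no  v≢c  =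
      contradiction (v , (λ v∈P → v∉ (x∈p∧x≢y⇒x∈p-y v∈P v≢c)) , ≡.sym eq) ¬twin
    ... | no  u≢c  | yes refl =
      contradiction (u , (λ u∈P → u∉ (x∈p∧x≢y⇒x∈p-y u∈P u≢c)) , eq) ¬twin
    ... | no  u≢c  | no  v≢c  =
      sep (λ u∈P → u∉ (x∈p∧x≢y⇒x∈p-y u∈P u≢c)) (λ v∈P → v∉ (x∈p∧x≢y⇒x∈p-y v∈P v≢c)) eq
  ... | yes (r , r∉P , Ir≡Ic) with separator (ident r c λ { refl → r∉P c∈P })
  ...   | x , x-separates = x , extend
    where
    D′ = D ∪ ⁅ x ⁆

    Ir≢Ic : I G D′ r ≢ I G D′ c
    Ir≢Ic = x-separates (q⊆p∪q D ⁅ x ⁆ (x∈⁅x⁆ x))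

    -- A collision with `c` under `D′` is one under `D`, hence with `r` too; this makes `u` equal to
    -- `r`, which `x` separates from `c`.
    no-twin : ∀ {u} → u ∉ P → I G D′ u ≢ I G D′ c
    no-twin u∉P eq with sep u∉P r∉P (trans (I-∪-injective D ⁅ x ⁆ eq) (≡.sym Ir≡Ic))
    ... | refl = Ir≢Ic eq

    extend : SeparatesOff (P - c) D′
    extend {u} {v} u∉ v∉ eq with u ≟ c | v ≟ c
    ... | yes refl | yes refl = refl
    ... | yes refl | no  v≢c  =
      contradiction (≡.sym eq) (no-twin (λ v∈P → v∉ (x∈p∧x≢y⇒x∈p-y v∈P v≢c)))
    ... | no  u≢c  | yes refl =
      contradiction eq (no-twin (λ u∈P → u∉ (x∈p∧x≢y⇒x∈p-y u∈P u≢c)))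
    ... | no  u≢c  | no  v≢c  =
      sep (λ u∈P → u∉ (x∈p∧x≢y⇒x∈p-y u∈P u≢c)) (λ v∈P → v∉ (x∈p∧x≢y⇒x∈p-y v∈P v≢c))
          (I-∪-injective D ⁅ x ⁆ eq)

  separate : Identifiable G → ∀ P D → SeparatesOff P D →
             ∃ λ E → ∣ E ∣ ≤ ∣ P ∣ × (∀ {u v} → I G (D ∪ E) u ≡ I G (D ∪ E) v → u ≡ v)
  separate ident P = go P (<-wellFounded ∣ P ∣)
    where
    go : ∀ P → Acc _<_ ∣ P ∣ → ∀ D → SeparatesOff P D →
         ∃ λ E → ∣ E ∣ ≤ ∣ P ∣ × (∀ {u v} → I G (D ∪ E) u ≡ I G (D ∪ E) v → u ≡ v)
    go P (acc rec) D sep with nonempty? P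
    ... | no  P≡∅ = ⊥ , subst (_≤ ∣ P ∣) (≡.sym (∣⊥∣≡0 n)) z≤n ,
                    λ {u} {v} → sep (λ u∈ → P≡∅ (u , u∈)) (λ v∈ → P≡∅ (v , v∈)) ∘ I-∪-injective D ⊥
    ... | yes (c , c∈P) with separate-one ident c∈P sep
    ...   | x , sep′ with go (P - c) (rec (x∈p⇒∣p-x∣<∣p∣ c∈P)) (D ∪ ⁅ x ⁆) sep′
    ...     | E , E≤ , inj =
      ⁅ x ⁆ ∪ E , bound ,
      λ {u} {v} → subst (λ F → I G F u ≡ I G F v → u ≡ v) (∪-assoc D ⁅ x ⁆ E) inj
      where
      open ≤-Reasoning
      bound : ∣ ⁅ x ⁆ ∪ E ∣ ≤ ∣ P ∣
      bound = begin
        ∣ ⁅ x ⁆ ∪ E ∣      ≤⟨ ∣p∪q∣≤∣p∣+∣q∣ ⁅ x ⁆ E ⟩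
        ∣ ⁅ x ⁆ ∣ + ∣ E ∣  ≤⟨ +-mono-≤ (≤-reflexive (∣⁅x⁆∣≡1 x)) E≤ ⟩
        suc ∣ P - c ∣      ≤⟨ x∈p⇒∣p-x∣<∣p∣ c∈P ⟩
        ∣ P ∣              ∎

  -- Neighbours and the construction of the code

  reachable⇒neighbour : ∀ {v w} → Reachable G v w → v ≢ w → ∃ λ x → adj G v x ≡ true
  reachable⇒neighbour here         v≢v = contradiction refl v≢v
  reachable⇒neighbour (step adj _) _   = _ , adj

  -- The size of `C` guarantees a vertex other than `v`, and the first edge of a path to it gives
  -- the neighbour.
  connected⇒neighbour : Connected G → ∀ (C : Subset n) → 2 ≤ ∣ C ∣ → ∀ v → ∃ λ x → adj G v x ≡ true
  connected⇒neighbour conn C 2≤∣C∣ v with any? (λ w → ¬? (v ≟ w))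
  ... | yes (w , v≢w) = reachable⇒neighbour (conn v w) v≢w
  ... | no  ¬other    = contradiction
    (≤-trans (p⊆q⇒∣p∣≤∣q∣ C⊆⁅v⁆) (≤-reflexive (∣⁅x⁆∣≡1 v))) (<⇒≱ 2≤∣C∣)
    where
    C⊆⁅v⁆ : C ⊆ ⁅ v ⁆
    C⊆⁅v⁆ {w} _ with v ≟ w
    ... | yes refl = x∈⁅x⁆ v
    ... | no  v≢w  = contradiction (w , v≢w) ¬other

  totalDominatingIdCode? : Decidable (TotalDominatingIdCode G)
  totalDominatingIdCode? C =
    all? (λ u → all? λ v → ¬? (u ≟ v) →-dec ¬? (≡-dec Bool._≟_ (I G C u) (I G C v)))
    ×-dec all? (λ v → any? λ u → (adj G v u Bool.≟ true) ×-dec (u ∈? C))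

  small-code : Connected G → Identifiable G → ∀ C → LocatingDominating G C → 2 ≤ ∣ C ∣ →
    ∃ λ F → TotalDominatingIdCode G F ×
    ∃ λ s → ∃ λ u → s ≤ ∣ C ∣ × suc s ≤ 2 ^ u × ∣ F ∣ + u ≤ ∣ C ∣ + s + ∣ C ∣
  small-code conn ident C (dom , loc) 2≤∣C∣ =
    F , (separating , total) , ∣ S ∣ , ∣ C ∩ Q ∣ , S≤C , S<2^ , size
    where
    locating : SeparatesOff C C
    locating {u} {v} u∉C v∉C eq with u ≟ v
    ... | yes u≡v = u≡v
    ... | no  u≢v = contradiction eq (loc u v u∉C v∉C u≢v)

    neighbour = connected⇒neighbour conn C 2≤∣C∣

    E = proj₁ (separate ident C C locating)
    E≤C = proj₁ (proj₂ (separate ident C C locating))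
    C∪E-separates = proj₂ (proj₂ (separate ident C C locating))

    -- `E` may meet `C`. Removing the overlap keeps the union and lets the locating property of `C`
    -- apply to all of `S`.
    S = E ─ C

    S≤C : ∣ S ∣ ≤ ∣ C ∣
    S≤C = ≤-trans (∣p─q∣≤∣p∣ E C) E≤C

    hasNeighbourInS? : Decidable (λ v → ∃ λ x → adj G v x ≡ true × x ∈ S)
    hasNeighbourInS? v = any? (λ x → (adj G v x Bool.≟ true) ×-dec (x ∈? S))

    Q = ⟦_⟧ hasNeighbourInS?

    I⊆C∩Q : ∀ {x} → x ∈ S → I G C x ⊆ C ∩ Q
    I⊆C∩Q {x} x∈S {y} y∈I with x∈p∩q⁻ (N[_] G x) C y∈I
    ... | y∈N , y∈C = x∈p∩q⁺ (y∈C , ∈⟦⟧⁺ hasNeighbourInS?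
      -- As `y` lies in `C` and `x` does not, they differ, so the closed neighbourhood gives a
      -- genuine edge.
      (x , trans (Graph.sym G y x) (∈N⇒adj y∈N (λ { refl → x∈p─q⇒x∉q E C x∈S y∈C })) , x∈S))

    S<2^ : suc ∣ S ∣ ≤ 2 ^ ∣ C ∩ Q ∣
    S<2^ = distinct-nonempty-subsets S (C ∩ Q) (I G C) I⊆C∩Q (λ {x} _ → dom x)
             (λ x∈S y∈S → locating (x∈p─q⇒x∉q E C x∈S) (x∈p─q⇒x∉q E C y∈S))

    neighbours = image (proj₁ ∘ neighbour) (C ─ Q)
    W = proj₁ neighbours

    F = (C ∪ E) ∪ W

    separating : ∀ u v → u ≢ v → I G F u ≢ I G F v
    separating u v u≢v = u≢v ∘ C∪E-separates ∘ I-∪-injective (C ∪ E) W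

    -- Vertices outside `C` have a neighbour in `C` by domination; those in `C` have one in `S` or
    -- else the one chosen in `W`.
    total : ∀ v → ∃ λ x → adj G v x ≡ true × x ∈ F
    total v with v ∈? C | hasNeighbourInS? v
    ... | no v∉C | _ with dom v
    ...   | y , y∈I with x∈p∩q⁻ (N[_] G v) C y∈I
    ...     | y∈N , y∈C = y , ∈N⇒adj y∈N (λ { refl → v∉C y∈C }) , p⊆p∪q W (p⊆p∪q E y∈C)
    total v | yes v∈C | yes (x , adj , x∈S) = x , adj , p⊆p∪q W (q⊆p∪q C E (p─q⊆p E C x∈S))
    total v | yes v∈C | no  ¬nbr = proj₁ (neighbour v) , proj₂ (neighbour v) ,
      q⊆p∪q (C ∪ E) W (proj₂ (proj₂ neighbours)
        (x∈p∧x∉q⇒x∈p─q v∈C (¬nbr ∘ ∈⟦⟧⁻ hasNeighbourInS?)))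

    C∪E⊆C∪S : C ∪ E ⊆ C ∪ S
    C∪E⊆C∪S {x} x∈ with x ∈? C
    ... | yes x∈C = p⊆p∪q S x∈C
    ... | no  x∉C with x∈p∪q⁻ C E x∈
    ...   | inj₁ x∈C = contradiction x∈C x∉C
    ...   | inj₂ x∈E = q⊆p∪q C S (x∈p∧x∉q⇒x∈p─q x∈E x∉C)

    size : ∣ F ∣ + ∣ C ∩ Q ∣ ≤ ∣ C ∣ + ∣ S ∣ + ∣ C ∣
    size = begin
      ∣ F ∣ + ∣ C ∩ Q ∣                          ≤⟨ +-monoˡ-≤ _ (∣p∪q∣≤∣p∣+∣q∣ (C ∪ E) W) ⟩
      ∣ C ∪ E ∣ + ∣ W ∣ + ∣ C ∩ Q ∣
        ≤⟨ +-monoˡ-≤ _ (+-mono-≤ (≤-trans (p⊆q⇒∣p∣≤∣q∣ C∪E⊆C∪S) (∣p∪q∣≤∣p∣+∣q∣ C S))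
                                 (proj₁ (proj₂ neighbours))) ⟩
      ∣ C ∣ + ∣ S ∣ + ∣ C ─ Q ∣ + ∣ C ∩ Q ∣      ≡⟨ +-assoc (∣ C ∣ + ∣ S ∣) _ _ ⟩
      ∣ C ∣ + ∣ S ∣ + (∣ C ─ Q ∣ + ∣ C ∩ Q ∣)
        ≡⟨ cong (∣ C ∣ + ∣ S ∣ +_) (trans (+-comm ∣ C ─ Q ∣ _) (∣p∩q∣+∣p─q∣≡∣p∣ C Q)) ⟩
      ∣ C ∣ + ∣ S ∣ + ∣ C ∣                      ∎
      where open ≤-Reasoning

-- The logarithmic bound

2^u+d≤2^[d+u] : ∀ u d → 2 ^ u + d ≤ 2 ^ (d + u)
2^u+d≤2^[d+u] u zero    = ≤-reflexive (+-comm (2 ^ u) 0)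
2^u+d≤2^[d+u] u (suc d) = begin
  2 ^ u + suc d                ≡⟨ +-suc (2 ^ u) d ⟩
  -- Raising `d` by one adds 1 on the left but doubles the right side, which is at least 1.
  1 + (2 ^ u + d)              ≤⟨ +-mono-≤ (m^n>0 2 (d + u)) (2^u+d≤2^[d+u] u d) ⟩
  2 ^ (d + u) + 2 ^ (d + u)    ≡⟨ cong (2 ^ (d + u) +_) (+-identityʳ (2 ^ (d + u))) ⟨
  2 ^ (suc d + u)              ∎
  where open ≤-Reasoning

-- `k + 1` is compared with an exact power of two, whose logarithm is an integer, so rounding up
-- costs nothing.
log-bound : ∀ {k s u} → s ≤ k → suc s ≤ 2 ^ u → s + ⌈log₂ (k + 1) ⌉ ≤ k + u
log-bound {k} {s} {u} s≤k s<2^u = begin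
  s + ⌈log₂ (k + 1) ⌉              ≤⟨ +-monoʳ-≤ s (⌈log₂⌉-mono-≤ k+1≤) ⟩
  s + ⌈log₂ (2 ^ (k ∸ s + u)) ⌉    ≡⟨ cong (s +_) (⌈log₂2^n⌉≡n (k ∸ s + u)) ⟩
  s + (k ∸ s + u)                  ≡⟨ +-assoc s (k ∸ s) u ⟨
  s + (k ∸ s) + u                  ≡⟨ cong (_+ u) (m+[n∸m]≡n s≤k) ⟩
  k + u                            ∎
  where
  open ≤-Reasoning
  k+1≤ : k + 1 ≤ 2 ^ (k ∸ s + u)
  k+1≤ = begin
    k + 1              ≡⟨ +-comm k 1 ⟩
    suc k              ≡⟨ cong suc (m+[n∸m]≡n s≤k) ⟨
    suc s + (k ∸ s)    ≤⟨ +-monoˡ-≤ (k ∸ s) s<2^u ⟩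
    2 ^ u + (k ∸ s)    ≤⟨ 2^u+d≤2^[d+u] u (k ∸ s) ⟩
    2 ^ (k ∸ s + u)    ∎

-- Since `t` and `3 * k` are integers, the bound with the rounded logarithm is equivalent to the one
-- with the real logarithm. Adding it on the left avoids truncated subtraction.
theorem20 : ∀ {n : ℕ} (G : Graph n) → Connected G → Identifiable G →
    ∀ (k : ℕ) → IsγL G k → 2 ≤ k →
    Σ ℕ (λ t → IsγtID G t × (t + ⌈log₂ (k + 1) ⌉ ≤ 3 * k))
theorem20 G conn ident k ((C , ld , refl) , _) 2≤k
  with small-code G conn ident C ld 2≤k
... | F , code , s , u , s≤k , s<2^u , F+u≤
  with minimum-size (totalDominatingIdCode? G) F code
... | M , M-code , M-min , M≤F =
  -- The saving `u` in the size of `F` and the loss `u` in the logarithm bound cancel.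
  ∣ M ∣ , ((M , M-code , refl) , M-min) , +-cancelʳ-≤ u _ _ bound
  where
  open ≤-Reasoning
  ℓ = ⌈log₂ (k + 1) ⌉
  bound : ∣ M ∣ + ℓ + u ≤ 3 * k + u
  bound = begin
    ∣ M ∣ + ℓ + u        ≤⟨ +-monoˡ-≤ u (+-monoˡ-≤ ℓ M≤F) ⟩
    ∣ F ∣ + ℓ + u        ≡⟨ rearrange₁ ∣ F ∣ ℓ u ⟩
    ∣ F ∣ + u + ℓ        ≤⟨ +-monoˡ-≤ ℓ F+u≤ ⟩
    k + s + k + ℓ        ≡⟨ rearrange₂ k s ℓ ⟩
    2 * k + (s + ℓ)      ≤⟨ +-monoʳ-≤ (2 * k) (log-bound s≤k s<2^u) ⟩
    2 * k + (k + u)      ≡⟨ rearrange₃ k u ⟩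
    3 * k + u            ∎
    where
    rearrange₁ : ∀ a b c → a + b + c ≡ a + c + b
    rearrange₁ = solve-∀
    rearrange₂ : ∀ a b c → a + b + a + c ≡ 2 * a + (b + c)
    rearrange₂ = solve-∀
    rearrange₃ : ∀ a b → 2 * a + (a + b) ≡ 3 * a + b
    rearrange₃ = solve-∀
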